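{- Let $G$ be a finite simple connected graph with at least two vertices and let $r \in V(G)$ be a target vertex. Let $I_{\text{sur}} = \{\, j \in \mathbb{N} : 1 \leq j \leq e(r)-1,\ 2^{e(r)-j} > |N_j(r)| \,\}$. Then the minimum WFL ratio $\lambda_{G,r}$ of the target $r$ on $G$ satisfies $$\lambda_{G,r} \;\geq\; n(G) - 1 + \sum_{j \in I_{\text{sur}}} \left( 2^{e(r)-j} - |N_j(r)| \right).$$
   Context: Notation. $n(G)$ is the number of vertices of $G$; $d_G(u,v)$ is the distance between $u$ and $v$ in $G$; $e(r) = \max_{u \in V(G)} d_G(u,r)$ is the eccentricity of $r$; for $j \geq 1$, $N_j(r) = \{u \in V(G) : d_G(u,r) = j\}$ is the $j$-th neighborhood of $r$. $r$-strategies. Let $T$ be a subtree of $G$ rooted at $r$ with $n(T) \geq 2$. The subtree $T$ is called an $r$-strategy when it is associated with a non-negative real-valued function $\omega_T$ on $V(G)$ (its weight function) such that $\omega_T(v) = 0$ if $v \notin V(T)$ or $v = r$, and $\omega_T(u) \geq 2\,\omega_T(v)$ for all $u, v \in V(T) \setminus \{r\}$ such that $u$ is the parent of $v$ in $T$. Put $|\omega_T| = \sum_{v \in V(G) \setminus \{r\}} \omega_T(v)$. WFL ratio. For a finite set $\mathcal{T}$ of $r$-strategies of $G$ (each being a subtree together with its weight function), let $\omega_{\mathcal{T}}(v) = \sum_{T \in \mathcal{T}} \omega_T(v)$, $|\omega_{\mathcal{T}}| = \sum_{T \in \mathcal{T}} |\omega_T|$, and $\omega_{\min} = \min_{v \in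 V(G) \setminus \{r\}} \omega_{\mathcal{T}}(v)$. When $\omega_{\min} > 0$, the WFL ratio of $\mathcal{T}$ is $\lambda_{\mathcal{T}} = |\omega_{\mathcal{T}}| / \omega_{\min}$. The minimum WFL ratio of the target $r$ is $\lambda_{G,r} = \min_{\mathcal{T}} \lambda_{\mathcal{T}}$, the minimum being over all finite sets $\mathcal{T}$ of $r$-strategies of $G$ with $\omega_{\min} > 0$. (Equivalently, $\lambda_{G,r}$ is the optimal value of the linear program: minimize $\sum_T \alpha_T |\omega_T|$ subject to $\sum_T \alpha_T \omega_T(v) \geq 1$ for all $v \in V(G) \setminus \{r\}$ and $\alpha_T \geq 0$, where $T$ ranges over all $r$-strategies of $G$.) -}

module Defs where

open import Data.Empty using (⊥-elim)
open import Data.Fin.Base using (Fin; punchIn)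
open import Data.Fin.Properties using (any?) renaming (_≟_ to _≟ᶠ_)
open import Data.Fin.Subset using (Subset; _∈_; _∉_; ∣_∣)
open import Data.Integer.Base using (+_)
open import Data.List.Base using (List; []; _∷_; map; foldr; filter; length; allFin; upTo)
open import Data.List.Relation.Unary.AllPairs using (AllPairs)
open import Data.List.Relation.Unary.Unique.Propositional using (Unique)
open import Data.Nat.Base as ℕ using (ℕ; zero; suc)
open import Data.Nat.ListAction using (sum)
import Data.Nat.Properties as ℕ
open import Data.Product using (Σ; Σ-syntax; ∃; ∃-syntax; _×_; _,_; proj₁; proj₂)
open import Data.Rational.Base as ℚ using (ℚ; 0ℚ; 1ℚ; ½; 1/_; positive; nonNegative)
import Data.Rational.Properties as ℚ
import Data.Rational.Solver as ℚ-Solver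
open import Data.Sum.Base using (inj₁; inj₂)
open import Level using (0ℓ)
open import Relation.Binary.Core using (Rel)
open import Relation.Binary.Definitions using (Decidable; Irreflexive; Symmetric)
open import Relation.Binary.PropositionalEquality
open import Relation.Nullary using (¬_; Dec; yes; no)
open import Relation.Nullary.Decidable using (map′; _×-dec_)
import Relation.Unary as U

recip : ℚ → ℚ
recip q with q ℚ.≟ 0ℚ
... | yes _   = 0ℚ
... | no  q≢0 = (1/ q) {{ℚ.≢-nonZero q≢0}}

module ℚ-Facts where
  ½-pos : ∀ {ε} → 0ℚ ℚ.< ε → 0ℚ ℚ.< ε ℚ.* ½
  ½-pos {ε} ε>0 = ℚ.positive⁻¹ _ {{ℚ.pos*pos⇒pos ε {{positive ε>0}} ½}}

  *-pos : ∀ {p q} → 0ℚ ℚ.< p → 0ℚ ℚ.< q → 0ℚ ℚ.< p ℚ.* q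
  *-pos {p} {q} p>0 q>0 =
    ℚ.positive⁻¹ _ {{ℚ.pos*pos⇒pos p {{positive p>0}} q {{positive q>0}}}}

  ½+½ : ∀ ε → ε ℚ.* ½ ℚ.+ ε ℚ.* ½ ≡ ε
  ½+½ ε = trans (sym (ℚ.*-distribˡ-+ ε ½ ½)) (ℚ.*-identityʳ ε)

  *-mono-≤ : ∀ {a b c d} → 0ℚ ℚ.≤ a → 0ℚ ℚ.≤ d → a ℚ.≤ b → c ℚ.≤ d →
             a ℚ.* c ℚ.≤ b ℚ.* d
  *-mono-≤ {a} {b} {c} {d} 0≤a 0≤d a≤b c≤d = ℚ.≤-trans
    (ℚ.*-monoˡ-≤-nonNeg a {{nonNegative 0≤a}} c≤d)
    (ℚ.*-monoʳ-≤-nonNeg d {{nonNegative 0≤d}} a≤b)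

  ∣-∣≤ : ∀ {p q} → p ℚ.≤ q → ℚ.- p ℚ.≤ q → ℚ.∣ p ∣ ℚ.≤ q
  ∣-∣≤ {p} {q} p≤q -p≤q with ℚ.∣p∣≡p∨∣p∣≡-p p
  ... | inj₁ eq = subst (ℚ._≤ q) (sym eq) p≤q
  ... | inj₂ eq = subst (ℚ._≤ q) (sym eq) -p≤q

  p≤∣p∣ : ∀ p → p ℚ.≤ ℚ.∣ p ∣
  p≤∣p∣ p with ℚ.≤-total 0ℚ p
  ... | inj₁ 0≤p = ℚ.≤-reflexive (sym (ℚ.0≤p⇒∣p∣≡p 0≤p))
  ... | inj₂ p≤0 = ℚ.≤-trans p≤0 (ℚ.0≤∣p∣ p)

  open ℚ-Solver.+-*-Solver

  neg-sub : ∀ p q → ℚ.- (p ℚ.- q) ≡ q ℚ.- p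
  neg-sub = solve 2 (λ p q → :- (p :- q) := q :- p) refl

  sub-add : ∀ p q → p ℚ.- q ℚ.+ q ≡ p
  sub-add = solve 2 (λ p q → p :- q :+ q := p) refl

  add-sub : ∀ p q → p ℚ.+ q ℚ.- q ≡ p
  add-sub = solve 2 (λ p q → p :+ q :- q := p) refl

  ∣p-q∣≡∣q-p∣ : ∀ p q → ℚ.∣ p ℚ.- q ∣ ≡ ℚ.∣ q ℚ.- p ∣
  ∣p-q∣≡∣q-p∣ p q = trans (sym (ℚ.∣-p∣≡∣p∣ (p ℚ.- q))) (cong ℚ.∣_∣ (neg-sub p q))

  close⇒≤ : ∀ p q {ε} → ℚ.∣ p ℚ.- q ∣ ℚ.≤ ε → p ℚ.≤ ε ℚ.+ q
  close⇒≤ p q h =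
    subst (ℚ._≤ _) (sub-add p q) (ℚ.+-monoˡ-≤ q (ℚ.≤-trans (p≤∣p∣ (p ℚ.- q)) h))

  close⇒≥ : ∀ p q {ε} → ℚ.∣ p ℚ.- q ∣ ℚ.≤ ε → q ℚ.≤ ε ℚ.+ p
  close⇒≥ p q h = close⇒≤ q p (subst (ℚ._≤ _) (∣p-q∣≡∣q-p∣ p q) h)

  ≤⇒diff : ∀ p q {ε} → p ℚ.≤ ε ℚ.+ q → p ℚ.- q ℚ.≤ ε
  ≤⇒diff p q {ε} h = subst (p ℚ.- q ℚ.≤_) (add-sub ε q) (ℚ.+-monoˡ-≤ (ℚ.- q) h)

  ≤≥⇒close : ∀ p q {ε} → p ℚ.≤ ε ℚ.+ q → q ℚ.≤ ε ℚ.+ p → ℚ.∣ p ℚ.- q ∣ ℚ.≤ ε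
  ≤≥⇒close p q h k =
    ∣-∣≤ (≤⇒diff p q h) (subst (ℚ._≤ _) (sym (neg-sub p q)) (≤⇒diff q p k))

  *-recip : ∀ {q} → 0ℚ ℚ.< q → q ℚ.* recip q ≡ 1ℚ
  *-recip {q} q>0 with q ℚ.≟ 0ℚ
  ... | yes q≡0 = ⊥-elim (ℚ.<-irrefl (sym q≡0) q>0)
  ... | no  q≢0 = ℚ.*-inverseʳ q {{ℚ.≢-nonZero q≢0}}

  recip-pos : ∀ {q} → 0ℚ ℚ.< q → 0ℚ ℚ.< recip q
  recip-pos {q} q>0 with q ℚ.≟ 0ℚ
  ... | yes q≡0 = ⊥-elim (ℚ.<-irrefl (sym q≡0) q>0)
  ... | no  q≢0 = ℚ.positive⁻¹ _ {{ℚ.1/pos⇒pos q {{positive q>0}}}}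

  recip-anti : ∀ {p q} → 0ℚ ℚ.< p → p ℚ.≤ q → recip q ℚ.≤ recip p
  recip-anti {p} {q} p>0 p≤q = begin
    recip q                          ≡⟨ sym (ℚ.*-identityʳ _) ⟩
    recip q ℚ.* 1ℚ                   ≡⟨ cong (recip q ℚ.*_) (sym (*-recip p>0)) ⟩
    recip q ℚ.* (p ℚ.* recip p)      ≤⟨ ℚ.*-monoˡ-≤-nonNeg (recip q) {{nonNegative (ℚ.<⇒≤ (recip-pos q>0))}}
                                          (ℚ.*-monoʳ-≤-nonNeg (recip p) {{nonNegative (ℚ.<⇒≤ (recip-pos p>0))}} p≤q) ⟩
    recip q ℚ.* (q ℚ.* recip p)      ≡⟨ solve 3 (λ a b c → a :* (b :* c) := (b :* a) :* c) refl (recip q) q (recip p) ⟩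
    (q ℚ.* recip q) ℚ.* recip p      ≡⟨ cong (ℚ._* recip p) (*-recip q>0) ⟩
    1ℚ ℚ.* recip p                   ≡⟨ ℚ.*-identityˡ _ ⟩
    recip p                          ∎
    where
    open ℚ.≤-Reasoning
    q>0 = ℚ.<-≤-trans p>0 p≤q

  recip-diff : ∀ {p q} → 0ℚ ℚ.< p → 0ℚ ℚ.< q →
               recip p ℚ.- recip q ≡ (q ℚ.- p) ℚ.* (recip p ℚ.* recip q)
  recip-diff {p} {q} p>0 q>0 = sym (begin
    (q ℚ.- p) ℚ.* (recip p ℚ.* recip q)
      ≡⟨ solve 4 (λ p q a b → (q :- p) :* (a :* b) := a :* (q :* b) :- (p :* a) :* b)
           refl p q (recip p) (recip q) ⟩
    recip p ℚ.* (q ℚ.* recip q) ℚ.- (p ℚ.* recip p) ℚ.* recip q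
      ≡⟨ cong₂ (λ u v → recip p ℚ.* u ℚ.- v ℚ.* recip q) (*-recip q>0) (*-recip p>0) ⟩
    recip p ℚ.* 1ℚ ℚ.- 1ℚ ℚ.* recip q
      ≡⟨ cong₂ ℚ._-_ (ℚ.*-identityʳ (recip p)) (ℚ.*-identityˡ (recip q)) ⟩
    recip p ℚ.- recip q ∎)
    where open ≡-Reasoning

open ℚ-Facts
open ℚ-Solver.+-*-Solver

------------------------------------------------------------------------
-- The real numbers, as Cauchy sequences of rationals

Cauchy : (ℕ → ℚ) → Set
Cauchy x = ∀ ε → 0ℚ ℚ.< ε →
  ∃[ N ] (∀ m n → N ℕ.≤ m → N ℕ.≤ n → ℚ.∣ x m ℚ.- x n ∣ ℚ.≤ ε)

record ℝ : Set where
  constructor mkℝ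
  field
    seq    : ℕ → ℚ
    cauchy : Cauchy seq

open ℝ public

infix  4 _≤ᴿ_ _<ᴿ_ _≃ᴿ_
infixl 6 _+ᴿ_
infixl 7 _*ᴿ_ _⊓ᴿ_

_≤ᴿ_ : Rel ℝ 0ℓ
x ≤ᴿ y = ∀ ε → 0ℚ ℚ.< ε → ∃[ N ] (∀ n → N ℕ.≤ n → seq x n ℚ.≤ seq y n ℚ.+ ε)

_<ᴿ_ : Rel ℝ 0ℓ
x <ᴿ y = ∃[ δ ] (0ℚ ℚ.< δ × ∃[ N ] (∀ n → N ℕ.≤ n → seq x n ℚ.+ δ ℚ.≤ seq y n))

-- Equality of real numbers; _≡_ would compare representing sequences.
_≃ᴿ_ : Rel ℝ 0ℓ
x ≃ᴿ y = x ≤ᴿ y × y ≤ᴿ x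

private abstract
  const-cauchy : ∀ q → Cauchy (λ _ → q)
  const-cauchy q ε ε>0 = 0 , λ _ _ _ _ →
    ≤≥⇒close q q (q≤ ε>0) (q≤ ε>0)
    where
    q≤ : ∀ {ε} → 0ℚ ℚ.< ε → q ℚ.≤ ε ℚ.+ q
    q≤ {ε} ε>0 = subst (ℚ._≤ ε ℚ.+ q) (ℚ.+-identityˡ q) (ℚ.+-monoˡ-≤ q (ℚ.<⇒≤ ε>0))

  +-cauchy : ∀ x y → Cauchy (λ n → seq x n ℚ.+ seq y n)
  +-cauchy x y ε ε>0 =
    let ε/2    = ε ℚ.* ½
        N , cx = cauchy x ε/2 (½-pos ε>0)
        M , cy = cauchy y ε/2 (½-pos ε>0)
    in N ℕ.⊔ M , λ m n m≥ n≥ →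
      let open ℚ.≤-Reasoning
          a = seq x m ; b = seq y m ; c = seq x n ; d = seq y n
      in begin
      ℚ.∣ a ℚ.+ b ℚ.- (c ℚ.+ d) ∣
        ≡⟨ cong ℚ.∣_∣ (solve 4 (λ a b c d → a :+ b :- (c :+ d) := (a :- c) :+ (b :- d)) refl a b c d) ⟩
      ℚ.∣ (a ℚ.- c) ℚ.+ (b ℚ.- d) ∣
        ≤⟨ ℚ.∣p+q∣≤∣p∣+∣q∣ (a ℚ.- c) (b ℚ.- d) ⟩
      ℚ.∣ a ℚ.- c ∣ ℚ.+ ℚ.∣ b ℚ.- d ∣
        ≤⟨ ℚ.+-mono-≤ (cx m n (ℕ.m⊔n≤o⇒m≤o N M m≥) (ℕ.m⊔n≤o⇒m≤o N M n≥))
                      (cy m n (ℕ.m⊔n≤o⇒n≤o N M m≥) (ℕ.m⊔n≤o⇒n≤o N M n≥)) ⟩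
      ε/2 ℚ.+ ε/2
        ≡⟨ ½+½ ε ⟩
      ε ∎

  ⊓-cauchy : ∀ x y → Cauchy (λ n → seq x n ℚ.⊓ seq y n)
  ⊓-cauchy x y ε ε>0 =
    let N , cx = cauchy x ε ε>0
        M , cy = cauchy y ε ε>0
    in N ℕ.⊔ M , λ m n m≥ n≥ →
      let hx = cx m n (ℕ.m⊔n≤o⇒m≤o N M m≥) (ℕ.m⊔n≤o⇒m≤o N M n≥)
          hy = cy m n (ℕ.m⊔n≤o⇒n≤o N M m≥) (ℕ.m⊔n≤o⇒n≤o N M n≥)
          a = seq x m ; b = seq y m ; c = seq x n ; d = seq y n
      in ≤≥⇒close (a ℚ.⊓ b) (c ℚ.⊓ d)
           (⊓-≤ ε a b c d (close⇒≤ a c hx) (close⇒≤ b d hy))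
           (⊓-≤ ε c d a b (close⇒≥ a c hx) (close⇒≥ b d hy))
    where
    ⊓-≤ : ∀ ε a b c d → a ℚ.≤ ε ℚ.+ c → b ℚ.≤ ε ℚ.+ d → a ℚ.⊓ b ℚ.≤ ε ℚ.+ (c ℚ.⊓ d)
    ⊓-≤ ε a b c d h k = subst (a ℚ.⊓ b ℚ.≤_)
      (sym (ℚ.mono-≤-distrib-⊓ (ℚ.+-monoʳ-≤ ε) c d)) (ℚ.⊓-mono-≤ h k)

  -- An eventual bound on the absolute value.
  bounded : ∀ (x : ℝ) → ∃[ B ] (0ℚ ℚ.< B × ∃[ N ] (∀ n → N ℕ.≤ n → ℚ.∣ seq x n ∣ ℚ.≤ B))
  bounded x =
    let N , c = cauchy x 1ℚ (ℚ.positive⁻¹ 1ℚ)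
        b     = seq x N
    in 1ℚ ℚ.+ ℚ.∣ b ∣
     , ℚ.<-≤-trans (ℚ.positive⁻¹ 1ℚ)
         (subst (ℚ._≤ 1ℚ ℚ.+ ℚ.∣ b ∣) (ℚ.+-identityʳ 1ℚ) (ℚ.+-monoʳ-≤ 1ℚ (ℚ.0≤∣p∣ b)))
     , N , λ n n≥ → let a = seq x n in ℚ.≤-trans
         (ℚ.≤-reflexive (cong ℚ.∣_∣ (sym (sub-add a b))))
         (ℚ.≤-trans (ℚ.∣p+q∣≤∣p∣+∣q∣ (a ℚ.- b) b)
           (ℚ.+-monoˡ-≤ ℚ.∣ b ∣ (c n N n≥ ℕ.≤-refl)))

  *-cauchy : ∀ x y → Cauchy (λ n → seq x n ℚ.* seq y n)
  *-cauchy x y ε ε>0 =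
    let A , A>0 , N₁ , bx = bounded x
        B , B>0 , N₂ , by = bounded y
        εx = ε ℚ.* ½ ℚ.* recip B
        εy = ε ℚ.* ½ ℚ.* recip A
        N₃ , cx = cauchy x εx (*-pos (½-pos ε>0) (recip-pos B>0))
        N₄ , cy = cauchy y εy (*-pos (½-pos ε>0) (recip-pos A>0))
    in (N₁ ℕ.⊔ N₂) ℕ.⊔ (N₃ ℕ.⊔ N₄) , λ m n m≥ n≥ →
      let open ℚ.≤-Reasoning
          a = seq x m ; b = seq y m ; c = seq x n ; d = seq y n
          m≥₁₂ = ℕ.m⊔n≤o⇒m≤o (N₁ ℕ.⊔ N₂) (N₃ ℕ.⊔ N₄) m≥
          m≥₃₄ = ℕ.m⊔n≤o⇒n≤o (N₁ ℕ.⊔ N₂) (N₃ ℕ.⊔ N₄) m≥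
          n≥₁₂ = ℕ.m⊔n≤o⇒m≤o (N₁ ℕ.⊔ N₂) (N₃ ℕ.⊔ N₄) n≥
          n≥₃₄ = ℕ.m⊔n≤o⇒n≤o (N₁ ℕ.⊔ N₂) (N₃ ℕ.⊔ N₄) n≥
          hx = cx m n (ℕ.m⊔n≤o⇒m≤o N₃ N₄ m≥₃₄) (ℕ.m⊔n≤o⇒m≤o N₃ N₄ n≥₃₄)
          hy = cy m n (ℕ.m⊔n≤o⇒n≤o N₃ N₄ m≥₃₄) (ℕ.m⊔n≤o⇒n≤o N₃ N₄ n≥₃₄)
      in begin
      ℚ.∣ a ℚ.* b ℚ.- c ℚ.* d ∣
        ≡⟨ cong ℚ.∣_∣ (solve 4 (λ a b c d → a :* b :- c :* d := (b :- d) :* a :+ (a :- c) :* d) refl a b c d) ⟩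
      ℚ.∣ (b ℚ.- d) ℚ.* a ℚ.+ (a ℚ.- c) ℚ.* d ∣
        ≤⟨ ℚ.∣p+q∣≤∣p∣+∣q∣ ((b ℚ.- d) ℚ.* a) ((a ℚ.- c) ℚ.* d) ⟩
      ℚ.∣ (b ℚ.- d) ℚ.* a ∣ ℚ.+ ℚ.∣ (a ℚ.- c) ℚ.* d ∣
        ≡⟨ cong₂ ℚ._+_ (ℚ.∣p*q∣≡∣p∣*∣q∣ (b ℚ.- d) a) (ℚ.∣p*q∣≡∣p∣*∣q∣ (a ℚ.- c) d) ⟩
      ℚ.∣ b ℚ.- d ∣ ℚ.* ℚ.∣ a ∣ ℚ.+ ℚ.∣ a ℚ.- c ∣ ℚ.* ℚ.∣ d ∣
        ≤⟨ ℚ.+-mono-≤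
             (*-mono-≤ (ℚ.0≤∣p∣ _) (ℚ.<⇒≤ A>0) hy (bx m (ℕ.m⊔n≤o⇒m≤o N₁ N₂ m≥₁₂)))
             (*-mono-≤ (ℚ.0≤∣p∣ _) (ℚ.<⇒≤ B>0) hx (by n (ℕ.m⊔n≤o⇒n≤o N₁ N₂ n≥₁₂))) ⟩
      εy ℚ.* A ℚ.+ εx ℚ.* B
        ≡⟨ cong₂ ℚ._+_ (cancel (ε ℚ.* ½) A>0) (cancel (ε ℚ.* ½) B>0) ⟩
      ε ℚ.* ½ ℚ.+ ε ℚ.* ½
        ≡⟨ ½+½ ε ⟩
      ε ∎
    where
    cancel : ∀ p {q} → 0ℚ ℚ.< q → p ℚ.* recip q ℚ.* q ≡ p
    cancel p {q} q>0 = trans (ℚ.*-assoc p (recip q) q)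
      (trans (cong (p ℚ.*_) (trans (ℚ.*-comm (recip q) q) (*-recip q>0))) (ℚ.*-identityʳ p))

  recip-cauchy : ∀ x δ N₁ → 0ℚ ℚ.< δ → (∀ n → N₁ ℕ.≤ n → 0ℚ ℚ.+ δ ℚ.≤ seq x n) →
                 Cauchy (λ n → recip (seq x n))
  recip-cauchy x δ N₁ δ>0 x≥ ε ε>0 =
    let ε′     = ε ℚ.* (δ ℚ.* δ)
        N₂ , c = cauchy x ε′ (*-pos ε>0 (*-pos δ>0 δ>0))
    in N₁ ℕ.⊔ N₂ , λ m n m≥ n≥ →
      let open ℚ.≤-Reasoning
          a  = seq x m ; b = seq x n
          a≥ = δ≤ m (ℕ.m⊔n≤o⇒m≤o N₁ N₂ m≥)
          b≥ = δ≤ n (ℕ.m⊔n≤o⇒m≤o N₁ N₂ n≥)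
          a>0 = ℚ.<-≤-trans δ>0 a≥
          b>0 = ℚ.<-≤-trans δ>0 b≥
          ra≥0 = ℚ.<⇒≤ (recip-pos a>0)
          rδ≥0 = ℚ.<⇒≤ (recip-pos δ>0)
          r≥0  = ℚ.<⇒≤ (*-pos (recip-pos a>0) (recip-pos b>0))
      in begin
      ℚ.∣ recip a ℚ.- recip b ∣
        ≡⟨ cong ℚ.∣_∣ (recip-diff a>0 b>0) ⟩
      ℚ.∣ (b ℚ.- a) ℚ.* (recip a ℚ.* recip b) ∣
        ≡⟨ ℚ.∣p*q∣≡∣p∣*∣q∣ (b ℚ.- a) (recip a ℚ.* recip b) ⟩
      ℚ.∣ b ℚ.- a ∣ ℚ.* ℚ.∣ recip a ℚ.* recip b ∣
        ≡⟨ cong (ℚ.∣ b ℚ.- a ∣ ℚ.*_) (ℚ.0≤p⇒∣p∣≡p r≥0) ⟩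
      ℚ.∣ b ℚ.- a ∣ ℚ.* (recip a ℚ.* recip b)
        ≤⟨ *-mono-≤ (ℚ.0≤∣p∣ _) (ℚ.<⇒≤ (*-pos (recip-pos δ>0) (recip-pos δ>0)))
             (c n m (ℕ.m⊔n≤o⇒n≤o N₁ N₂ n≥) (ℕ.m⊔n≤o⇒n≤o N₁ N₂ m≥))
             (*-mono-≤ ra≥0 rδ≥0 (recip-anti δ>0 a≥) (recip-anti δ>0 b≥)) ⟩
      ε ℚ.* (δ ℚ.* δ) ℚ.* (recip δ ℚ.* recip δ)
        ≡⟨ solve 3 (λ e d r → e :* (d :* d) :* (r :* r) := e :* ((d :* r) :* (d :* r))) refl ε δ (recip δ) ⟩
      ε ℚ.* ((δ ℚ.* recip δ) ℚ.* (δ ℚ.* recip δ))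
        ≡⟨ cong (λ u → ε ℚ.* (u ℚ.* u)) (*-recip δ>0) ⟩
      ε ℚ.* (1ℚ ℚ.* 1ℚ)
        ≡⟨ ℚ.*-identityʳ ε ⟩
      ε ∎
    where
    δ≤ : ∀ n → N₁ ℕ.≤ n → δ ℚ.≤ seq x n
    δ≤ n n≥ = subst (ℚ._≤ seq x n) (ℚ.+-identityˡ δ) (x≥ n n≥)

fromℚ : ℚ → ℝ
fromℚ q = mkℝ (λ _ → q) (const-cauchy q)

fromℕ : ℕ → ℝ
fromℕ k = fromℚ (+ k ℚ./ 1)

0ᴿ : ℝ
0ᴿ = fromℕ 0

_+ᴿ_ : ℝ → ℝ → ℝ
x +ᴿ y = mkℝ (λ n → seq x n ℚ.+ seq y n) (+-cauchy x y)

_⊓ᴿ_ : ℝ → ℝ → ℝ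
x ⊓ᴿ y = mkℝ (λ n → seq x n ℚ.⊓ seq y n) (⊓-cauchy x y)

_*ᴿ_ : ℝ → ℝ → ℝ
x *ᴿ y = mkℝ (λ n → seq x n ℚ.* seq y n) (*-cauchy x y)

-- The reciprocal of a positive real.  Only finitely many terms of the
-- sequence can be affected by the convention recip 0ℚ = 0ℚ.
invᴿ : (x : ℝ) → 0ᴿ <ᴿ x → ℝ
invᴿ x (δ , δ>0 , N , x≥) = mkℝ (λ n → recip (seq x n)) (recip-cauchy x δ N δ>0 x≥)

sumᴿ : List ℝ → ℝ
sumᴿ = foldr _+ᴿ_ 0ᴿ

minᴿ : ∀ {k} → (Fin (suc k) → ℝ) → ℝ
minᴿ {zero}  f = f Fin.zero
minᴿ {suc k} f = f Fin.zero ⊓ᴿ minᴿ (λ i → f (Fin.suc i))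

------------------------------------------------------------------------
-- Graphs, walks and distance

record Graph (n : ℕ) : Set₁ where
  field
    Adj        : Rel (Fin n) 0ℓ
    adj?       : Decidable Adj
    adj-sym    : Symmetric Adj
    adj-irrefl : Irreflexive _≡_ Adj

module _ {n : ℕ} where

  data Walk (R : Rel (Fin n) 0ℓ) : Fin n → Fin n → ℕ → Set where
    []  : ∀ {u} → Walk R u u 0
    _∷_ : ∀ {u v w k} → R u v → Walk R v w k → Walk R u w (suc k)

  vertices : ∀ {R u v k} → Walk R u v k → List (Fin n)
  vertices {u = u} []      = u ∷ []
  vertices {u = u} (_ ∷ p) = u ∷ vertices p

  IsPath : ∀ {R u v k} → Walk R u v k → Set
  IsPath p = Unique (vertices p)

  -- A cycle is a path on at least three vertices together with an edge
  -- joining its ends.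
  Acyclic : Rel (Fin n) 0ℓ → Set
  Acyclic R = ∀ {u v k} (p : Walk R u v k) → IsPath p → 2 ℕ.≤ k → ¬ R v u

  walk? : ∀ {R} → Decidable R → ∀ k u v → Dec (Walk R u v k)
  walk? R? zero    u v = map′ (λ { refl → [] }) (λ { [] → refl }) (u ≟ᶠ v)
  walk? R? (suc k) u v =
    map′ (λ (_ , e , p) → e ∷ p) (λ { (e ∷ p) → _ , e , p })
         (any? λ w → R? u w ×-dec walk? R? k w v)

least : ∀ {P : ℕ → Set} → U.Decidable P → ∃ P →
        ∃[ k ] (P k × (∀ j → j ℕ.< k → ¬ P j))
least P? (k , pk) = go k P? pk
  where
  go : ∀ {P : ℕ → Set} k → U.Decidable P → P k → ∃[ i ] (P i × (∀ j → j ℕ.< i → ¬ P j))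
  go zero    P? p0 = 0 , p0 , λ _ ()
  go (suc k) P? pk with P? 0
  ... | yes p0 = 0 , p0 , λ _ ()
  ... | no ¬p0 with go k (λ j → P? (suc j)) pk
  ...   | i , pi , below = suc i , pi , λ where
            zero    _         → ¬p0
            (suc j) (ℕ.s≤s h) → below j h

Connected : ∀ {n} → Graph n → Set
Connected G = ∀ u v → ∃ (Walk (Graph.Adj G) u v)

module _ {n : ℕ} (G : Graph n) (conn : Connected G) where

  open Graph G

  dist : Fin n → Fin n → ℕ
  dist u v = proj₁ (least (λ k → walk? adj? k u v) (conn u v))

  ecc : Fin n → ℕ
  ecc r = foldr ℕ._⊔_ 0 (map (λ u → dist u r) (allFin n))

  nbhd : ℕ → Fin n → List (Fin n)
  nbhd j r = filter (λ u → dist u r ℕ.≟ j) (allFin n)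

  ∣N∣ : ℕ → Fin n → ℕ
  ∣N∣ j r = length (nbhd j r)

  Isur : Fin n → List ℕ
  Isur r = filter
    (λ j → 1 ℕ.≤? j ×-dec j ℕ.≤? ecc r ℕ.∸ 1 ×-dec ∣N∣ j r ℕ.<? 2 ℕ.^ (ecc r ℕ.∸ j))
    (upTo (ecc r))

  -- Truncated subtraction is exact on Isur.
  surplus : Fin n → ℕ
  surplus r = sum (map (λ j → 2 ℕ.^ (ecc r ℕ.∸ j) ℕ.∸ ∣N∣ j r) (Isur r))

------------------------------------------------------------------------
-- Rooted subtrees and strategies

record Subtree {n : ℕ} (G : Graph n) (r : Fin n) : Set₁ where
  field
    V         : Subset n
    Edge      : Rel (Fin n) 0ℓ
    edge?     : Decidable Edge
    edge-sym  : Symmetric Edge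
    edge⊆adj  : ∀ {u v} → Edge u v → Graph.Adj G u v
    edge⊆V    : ∀ {u v} → Edge u v → u ∈ V
    connected : ∀ {u v} → u ∈ V → v ∈ V → ∃ (Walk Edge u v)
    acyclic   : Acyclic Edge
    root∈V    : r ∈ V
    size≥2    : 2 ℕ.≤ ∣ V ∣

  -- u is the parent of v when u follows v on the path from v to the root.
  Parent : Fin n → Fin n → Set
  Parent u v = Σ[ e ∈ Edge v u ] ∃[ k ] Σ[ p ∈ Walk Edge u r k ] IsPath (e ∷ p)

record Strategy {n : ℕ} (G : Graph n) (r : Fin n) : Set₁ where
  field
    tree : Subtree G r
  open Subtree tree public
  field
    ω         : Fin n → ℝ
    ω-nonneg  : ∀ v → 0ᴿ ≤ᴿ ω v
    ω-outside : ∀ {v} → v ∉ V → ω v ≃ᴿ 0ᴿ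
    ω-root    : ω r ≃ᴿ 0ᴿ
    ω-parent  : ∀ {u v} → u ∈ V → v ∈ V → u ≢ r → v ≢ r → Parent u v →
                fromℕ 2 *ᴿ ω v ≤ᴿ ω u

open Strategy using (ω)

-- Equality of strategies: same subtree of G and same weight function.
record _≈ˢ_ {n : ℕ} {G : Graph n} {r : Fin n} (S T : Strategy G r) : Set where
  private
    module S = Strategy S
    module T = Strategy T
  field
    V-≡    : S.V ≡ T.V
    Edge-⊆ : ∀ {u v} → S.Edge u v → T.Edge u v
    Edge-⊇ : ∀ {u v} → T.Edge u v → S.Edge u v
    ω-≃    : ∀ v → S.ω v ≃ᴿ T.ω v

-- A finite set, as a list of pairwise distinct elements.
record StrategySet {n : ℕ} (G : Graph n) (r : Fin n) : Set₁ where
  constructor mkSet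
  field
    elements : List (Strategy G r)
    distinct : AllPairs (λ S T → ¬ S ≈ˢ T) elements

open StrategySet public

------------------------------------------------------------------------
-- The WFL ratio

-- On a graph with 2 + m vertices, punchIn r enumerates the 1 + m vertices
-- other than r.
module _ {m : ℕ} {G : Graph (2 ℕ.+ m)} {r : Fin (2 ℕ.+ m)} where

  ∣ω∣ : Strategy G r → ℝ
  ∣ω∣ T = sumᴿ (map (λ i → ω T (punchIn r i)) (allFin (suc m)))

  ωSet : StrategySet G r → Fin (2 ℕ.+ m) → ℝ
  ωSet 𝒯 v = sumᴿ (map (λ T → ω T v) (elements 𝒯))

  ∣ωSet∣ : StrategySet G r → ℝ
  ∣ωSet∣ 𝒯 = sumᴿ (map ∣ω∣ (elements 𝒯))

  ωmin : StrategySet G r → ℝ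
  ωmin 𝒯 = minᴿ (λ i → ωSet 𝒯 (punchIn r i))

  wflRatio : (𝒯 : StrategySet G r) → 0ᴿ <ᴿ ωmin 𝒯 → ℝ
  wflRatio 𝒯 ωmin>0 = ∣ωSet∣ 𝒯 *ᴿ invᴿ (ωmin 𝒯) ωmin>0

-- ℓ is the minimum WFL ratio of the target r.
record IsMinWFLRatio {m : ℕ} (G : Graph (2 ℕ.+ m)) (r : Fin (2 ℕ.+ m)) (ℓ : ℝ) : Set₁ where
  field
    attained : Σ[ 𝒯 ∈ StrategySet G r ] Σ[ ωmin>0 ∈ 0ᴿ <ᴿ ωmin 𝒯 ] wflRatio 𝒯 ωmin>0 ≃ᴿ ℓ
    minimal  : ∀ (𝒯 : StrategySet G r) (ωmin>0 : 0ᴿ <ᴿ ωmin 𝒯) → ℓ ≤ᴿ wflRatio 𝒯 ωmin>0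

{-# OPTIONS --safe #-}
module Submission where

-- Fix x at maximal distance e = e(r).  A strategy tree containing x contains a
-- path from x to r, which meets every level N_j with 1 ≤ j ≤ e; weights double
-- along it, so N_j carries at least 2^(e-j) times the weight of x.  Summing over
-- the strategies, N_j carries at least 2^(e-j) ωmin, besides the trivial bound
-- |N_j| ωmin.  Using the former on the levels in Isur and the latter on the
-- other vertices bounds the total weight below by (n - 1 + surplus) ωmin.

open import Defs
open import Data.Fin.Base using (Fin)
open import Data.Nat.Base using (ℕ; _+_; _∸_)
open import Data.Product using (_×_)

open import Data.Fin.Base using (zero; suc; punchIn)
open import Data.Fin.Properties using (punchIn-punchOut) renaming (_≟_ to _≟ᶠ_)
open import Data.Fin.Subset.Properties using (_∈?_)
open import Data.Integer.Base as ℤ using (+_)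
import Data.Integer.Properties as ℤ
open import Data.List.Base using (List; []; _∷_; map; filter; length; tabulate; allFin; upTo)
open import Data.List.Membership.Propositional using (_∈_)
open import Data.List.Membership.Propositional.Properties
  using (∈-allFin; ∈-filter⁺; ∈-filter⁻; ∈-map⁺; ∈-map⁻; foldr-selective)
import Data.List.Membership.DecPropositional as DecMembership
open import Data.List.Properties
  using (filter-reject; map-cong; map-∘; map-tabulate; length-map; length-tabulate)
open import Data.List.Relation.Binary.Permutation.Propositional
  using (_↭_; prep; swap; ↭-refl; ↭-trans)
open import Data.List.Relation.Binary.Permutation.Propositional.Properties
  using (↭-length; filter-↭)
open import Data.List.Relation.Unary.All using ([]; lookup)
open import Data.List.Relation.Unary.All.Properties using (¬Any⇒All¬)
open import Data.List.Relation.Unary.AllPairs using ([]; _∷_)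
open import Data.List.Relation.Unary.Any using (here; there)
open import Data.List.Relation.Unary.Unique.Propositional using (Unique)
open import Data.List.Relation.Unary.Unique.Propositional.Properties using (upTo⁺; filter⁺)
open import Data.Nat.Base as ℕ using (_*_; _^_)
open import Data.Nat.ListAction using (sum)
import Data.Nat.Properties as ℕ
open import Algebra.Properties.CommutativeSemigroup ℕ.+-commutativeSemigroup using (interchange)
open import Data.Product using (∃-syntax; Σ-syntax; _,_; proj₁; proj₂)
open import Data.Rational.Base as ℚ using (0ℚ; 1ℚ; ½; nonNegative)
import Data.Rational.Properties as ℚ
import Data.Rational.Solver as ℚ-Solver
open import Data.Rational.Unnormalised.Base as ℚᵘ using (ℚᵘ; mkℚᵘ; *≡*)
import Data.Rational.Unnormalised.Properties as ℚᵘ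
open import Data.Sum.Base using (inj₁; inj₂)
open import Function.Base using (_∘_; id)
open import Relation.Binary.PropositionalEquality
open import Relation.Nullary using (¬_; yes; no; contradiction)
open import Relation.Unary using (Pred; Decidable)
open import Relation.Nullary.Decidable using (¬?)

open Strategy using (ω)
open ℚ-Facts
open ℚ-Solver.+-*-Solver using (solve; _:+_; _:*_; _:=_)

-- The embedding of the naturals into the rationals.

fromℕᵘ : ℕ → ℚᵘ
fromℕᵘ k = mkℚᵘ (+ k) 0

toℚᵘ-/1 : ∀ k → ℚ.toℚᵘ (+ k ℚ./ 1) ℚᵘ.≃ fromℕᵘ k
toℚᵘ-/1 k = ℚ.toℚᵘ-fromℚᵘ (fromℕᵘ k)

-- Normalised rationals are reduced by a gcd, which is stuck on variables. On unnormalised fractions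
-- of denominator one the claim is an identity of integers, and `ℚ.toℚᵘ` carries it back.
+-/1 : ∀ a b → + (a + b) ℚ./ 1 ≡ (+ a ℚ./ 1) ℚ.+ (+ b ℚ./ 1)
+-/1 a b = ℚ.toℚᵘ-injective (begin
  ℚ.toℚᵘ (+ (a + b) ℚ./ 1)                       ≈⟨ toℚᵘ-/1 (a + b) ⟩
  fromℕᵘ (a + b)                                  ≈⟨ *≡* (cong (ℤ._* + 1)
                                                       (sym (cong₂ ℤ._+_ (ℤ.*-identityʳ (+ a)) (ℤ.*-identityʳ (+ b))))) ⟩
  fromℕᵘ a ℚᵘ.+ fromℕᵘ b                          ≈⟨ ℚᵘ.+-cong (toℚᵘ-/1 a) (toℚᵘ-/1 b) ⟨
  ℚ.toℚᵘ (+ a ℚ./ 1) ℚᵘ.+ ℚ.toℚᵘ (+ b ℚ./ 1)     ≈⟨ ℚ.toℚᵘ-homo-+ (+ a ℚ./ 1) (+ b ℚ./ 1) ⟨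
  ℚ.toℚᵘ ((+ a ℚ./ 1) ℚ.+ (+ b ℚ./ 1))           ∎)
  where open import Relation.Binary.Reasoning.Setoid ℚᵘ.≃-setoid

*-/1 : ∀ a b → + (a * b) ℚ./ 1 ≡ (+ a ℚ./ 1) ℚ.* (+ b ℚ./ 1)
*-/1 a b = ℚ.toℚᵘ-injective (begin
  ℚ.toℚᵘ (+ (a * b) ℚ./ 1)                       ≈⟨ toℚᵘ-/1 (a * b) ⟩
  fromℕᵘ (a * b)                                  ≈⟨ *≡* (cong (ℤ._* + 1) (ℤ.pos-* a b)) ⟩
  fromℕᵘ a ℚᵘ.* fromℕᵘ b                          ≈⟨ ℚᵘ.*-cong (toℚᵘ-/1 a) (toℚᵘ-/1 b) ⟨
  ℚ.toℚᵘ (+ a ℚ./ 1) ℚᵘ.* ℚ.toℚᵘ (+ b ℚ./ 1)     ≈⟨ ℚ.toℚᵘ-homo-* (+ a ℚ./ 1) (+ b ℚ./ 1) ⟨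
  ℚ.toℚᵘ ((+ a ℚ./ 1) ℚ.* (+ b ℚ./ 1))           ∎)
  where open import Relation.Binary.Reasoning.Setoid ℚᵘ.≃-setoid

0≤-/1 : ∀ k → 0ℚ ℚ.≤ + k ℚ./ 1
0≤-/1 k = ℚ.nonNegative⁻¹ (+ k ℚ./ 1) {{ℚ.normalize-nonNeg k 1}}

-- Order on ℝ

-- `_≤ᴿ_` unfolds to a relation between sequences, which does not determine the Cauchy proofs; hence
-- the reals are mostly passed explicitly from here on.
pointwise⇒≤ᴿ : ∀ x y → (∀ n → seq x n ℚ.≤ seq y n) → x ≤ᴿ y
pointwise⇒≤ᴿ x y x≤y ε ε>0 = 0 , λ n _ →
  ℚ.≤-trans (x≤y n) (subst (ℚ._≤ seq y n ℚ.+ ε) (ℚ.+-identityʳ (seq y n))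
    (ℚ.+-monoʳ-≤ (seq y n) (ℚ.<⇒≤ ε>0)))

pointwise≡⇒≤ᴿ : ∀ x y → (∀ n → seq x n ≡ seq y n) → x ≤ᴿ y
pointwise≡⇒≤ᴿ x y x≡y = pointwise⇒≤ᴿ x y λ n → ℚ.≤-reflexive (x≡y n)

≤ᴿ-refl : ∀ x → x ≤ᴿ x
≤ᴿ-refl x = pointwise⇒≤ᴿ x x λ _ → ℚ.≤-refl

≤ᴿ-trans : ∀ x y z → x ≤ᴿ y → y ≤ᴿ z → x ≤ᴿ z
≤ᴿ-trans x y z x≤y y≤z ε ε>0 =
  let N , p = x≤y (ε ℚ.* ½) (½-pos ε>0)
      M , q = y≤z (ε ℚ.* ½) (½-pos ε>0)
  in N ℕ.⊔ M , λ n n≥ → begin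
    seq x n                             ≤⟨ p n (ℕ.m⊔n≤o⇒m≤o N M n≥) ⟩
    seq y n ℚ.+ ε ℚ.* ½                 ≤⟨ ℚ.+-monoˡ-≤ (ε ℚ.* ½) (q n (ℕ.m⊔n≤o⇒n≤o N M n≥)) ⟩
    seq z n ℚ.+ ε ℚ.* ½ ℚ.+ ε ℚ.* ½     ≡⟨ ℚ.+-assoc (seq z n) _ _ ⟩
    seq z n ℚ.+ (ε ℚ.* ½ ℚ.+ ε ℚ.* ½)   ≡⟨ cong (seq z n ℚ.+_) (½+½ ε) ⟩
    seq z n ℚ.+ ε                       ∎
  where open ℚ.≤-Reasoning

module ≤ᴿ-Reasoning where
  open import Relation.Binary.Reasoning.Base.Single _≤ᴿ_
    (λ {x} → ≤ᴿ-refl x) (λ {x} {y} {z} → ≤ᴿ-trans x y z) public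

+ᴿ-mono-≤ᴿ : ∀ x y u v → x ≤ᴿ y → u ≤ᴿ v → x +ᴿ u ≤ᴿ y +ᴿ v
+ᴿ-mono-≤ᴿ x y u v x≤y u≤v ε ε>0 =
  let N , p = x≤y (ε ℚ.* ½) (½-pos ε>0)
      M , q = u≤v (ε ℚ.* ½) (½-pos ε>0)
  in N ℕ.⊔ M , λ n n≥ → begin
    seq x n ℚ.+ seq u n
      ≤⟨ ℚ.+-mono-≤ (p n (ℕ.m⊔n≤o⇒m≤o N M n≥)) (q n (ℕ.m⊔n≤o⇒n≤o N M n≥)) ⟩
    (seq y n ℚ.+ ε ℚ.* ½) ℚ.+ (seq v n ℚ.+ ε ℚ.* ½)
      ≡⟨ solve 3 (λ a b c → (a :+ c) :+ (b :+ c) := (a :+ b) :+ (c :+ c)) refl (seq y n) (seq v n) (ε ℚ.* ½) ⟩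
    seq y n ℚ.+ seq v n ℚ.+ (ε ℚ.* ½ ℚ.+ ε ℚ.* ½)
      ≡⟨ cong (seq y n ℚ.+ seq v n ℚ.+_) (½+½ ε) ⟩
    seq y n ℚ.+ seq v n ℚ.+ ε ∎
  where open ℚ.≤-Reasoning

-- The bound is used at precision ε / (1 + k), since k may vanish.
fromℕ-*-monoʳ : ∀ k x y → x ≤ᴿ y → fromℕ k *ᴿ x ≤ᴿ fromℕ k *ᴿ y
fromℕ-*-monoʳ k x y x≤y ε ε>0 =
  let q      = + k ℚ./ 1
      c      = 1ℚ ℚ.+ q
      0≤q    = 0≤-/1 k
      c>0    = ℚ.+-mono-<-≤ (ℚ.positive⁻¹ 1ℚ) 0≤q
      δ      = ε ℚ.* recip c
      δ>0    = *-pos ε>0 (recip-pos c>0)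
      N , h  = x≤y δ δ>0
  in N , λ n n≥ → begin
    q ℚ.* seq x n                ≤⟨ ℚ.*-monoˡ-≤-nonNeg q {{nonNegative 0≤q}} (h n n≥) ⟩
    q ℚ.* (seq y n ℚ.+ δ)        ≡⟨ ℚ.*-distribˡ-+ q (seq y n) δ ⟩
    q ℚ.* seq y n ℚ.+ q ℚ.* δ    ≤⟨ ℚ.+-monoʳ-≤ (q ℚ.* seq y n)
                                      (ℚ.*-monoʳ-≤-nonNeg δ {{nonNegative (ℚ.<⇒≤ δ>0)}}
                                        (subst (ℚ._≤ c) (ℚ.+-identityˡ q) (ℚ.+-monoˡ-≤ q (ℚ.<⇒≤ (ℚ.positive⁻¹ 1ℚ))))) ⟩
    q ℚ.* seq y n ℚ.+ c ℚ.* δ    ≡⟨ cong (q ℚ.* seq y n ℚ.+_)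
                                      (trans (solve 3 (λ a b d → a :* (b :* d) := b :* (a :* d)) refl c ε (recip c))
                                        (trans (cong (ε ℚ.*_) (*-recip c>0)) (ℚ.*-identityʳ ε))) ⟩
    q ℚ.* seq y n ℚ.+ ε          ∎
  where open ℚ.≤-Reasoning

fromℕ-*-distribʳ : ∀ a b x → ∀ n →
  seq (fromℕ (a + b) *ᴿ x) n ≡ seq (fromℕ a *ᴿ x +ᴿ fromℕ b *ᴿ x) n
fromℕ-*-distribʳ a b x n = trans (cong (ℚ._* seq x n) (+-/1 a b))
  (ℚ.*-distribʳ-+ (seq x n) (+ a ℚ./ 1) (+ b ℚ./ 1))

fromℕ-*-nonneg : ∀ k x → 0ᴿ ≤ᴿ x → 0ᴿ ≤ᴿ fromℕ k *ᴿ x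
fromℕ-*-nonneg k x 0≤x = ≤ᴿ-trans 0ᴿ (fromℕ k *ᴿ 0ᴿ) (fromℕ k *ᴿ x)
  (pointwise≡⇒≤ᴿ 0ᴿ (fromℕ k *ᴿ 0ᴿ) λ _ → sym (ℚ.*-zeroʳ (+ k ℚ./ 1)))
  (fromℕ-*-monoʳ k 0ᴿ x 0≤x)

x≤ᴿx+y : ∀ x y → 0ᴿ ≤ᴿ y → x ≤ᴿ x +ᴿ y
x≤ᴿx+y x y 0≤y = ≤ᴿ-trans x (x +ᴿ 0ᴿ) (x +ᴿ y)
  (pointwise≡⇒≤ᴿ x (x +ᴿ 0ᴿ) λ n → sym (ℚ.+-identityʳ (seq x n)))
  (+ᴿ-mono-≤ᴿ x x 0ᴿ y (≤ᴿ-refl x) 0≤y)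

y≤ᴿx+y : ∀ x y → 0ᴿ ≤ᴿ x → y ≤ᴿ x +ᴿ y
y≤ᴿx+y x y 0≤x = ≤ᴿ-trans y (y +ᴿ x) (x +ᴿ y) (x≤ᴿx+y y x 0≤x)
  (pointwise≡⇒≤ᴿ (y +ᴿ x) (x +ᴿ y) λ n → ℚ.+-comm (seq y n) (seq x n))

fromℕ-*-monoˡ : ∀ {a b} x → 0ᴿ ≤ᴿ x → a ℕ.≤ b → fromℕ a *ᴿ x ≤ᴿ fromℕ b *ᴿ x
fromℕ-*-monoˡ {a} {b} x 0≤x a≤b = begin
  fromℕ a *ᴿ x                          ∼⟨ x≤ᴿx+y (fromℕ a *ᴿ x) (fromℕ (b ∸ a) *ᴿ x) (fromℕ-*-nonneg (b ∸ a) x 0≤x) ⟩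
  fromℕ a *ᴿ x +ᴿ fromℕ (b ∸ a) *ᴿ x    ∼⟨ pointwise≡⇒≤ᴿ (fromℕ a *ᴿ x +ᴿ fromℕ (b ∸ a) *ᴿ x) (fromℕ (a + (b ∸ a)) *ᴿ x)
                                             (λ n → sym (fromℕ-*-distribʳ a (b ∸ a) x n)) ⟩
  fromℕ (a + (b ∸ a)) *ᴿ x              ≡⟨ cong (λ c → fromℕ c *ᴿ x) (ℕ.m+[n∸m]≡n a≤b) ⟩
  fromℕ b *ᴿ x                          ∎
  where open ≤ᴿ-Reasoning

-- The positivity witness bounds `w` below by `δ` from `N` on. Taking the hypothesis at precision
-- `ε ℚ.* δ` leaves, after division by `wₙ`, an error of `ε` times `δ / wₙ`, which is at most `ε`.
≤ᴿ-*-invᴿ : ∀ c w s (w>0 : 0ᴿ <ᴿ w) → c *ᴿ w ≤ᴿ s → c ≤ᴿ s *ᴿ invᴿ w w>0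
≤ᴿ-*-invᴿ c w s (δ , δ>0 , N , w≥) cw≤s ε ε>0 =
  let M , h = cw≤s (ε ℚ.* δ) (*-pos ε>0 δ>0)
  in N ℕ.⊔ M , λ n n≥ →
    let cₙ = seq c n ; wₙ = seq w n ; sₙ = seq s n ; r = recip wₙ
        δ≤w = subst (ℚ._≤ wₙ) (ℚ.+-identityˡ δ) (w≥ n (ℕ.m⊔n≤o⇒m≤o N M n≥))
        w>0 = ℚ.<-≤-trans δ>0 δ≤w
        r≥0 = ℚ.<⇒≤ (recip-pos w>0)
    in begin
    cₙ                                ≡⟨ sym (trans (cong (cₙ ℚ.*_) (*-recip w>0)) (ℚ.*-identityʳ cₙ)) ⟩
    cₙ ℚ.* (wₙ ℚ.* r)                 ≡⟨ sym (ℚ.*-assoc cₙ wₙ r) ⟩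
    cₙ ℚ.* wₙ ℚ.* r                   ≤⟨ ℚ.*-monoʳ-≤-nonNeg r {{nonNegative r≥0}} (h n (ℕ.m⊔n≤o⇒n≤o N M n≥)) ⟩
    (sₙ ℚ.+ ε ℚ.* δ) ℚ.* r            ≡⟨ solve 4 (λ s e d r → (s :+ e :* d) :* r := s :* r :+ e :* (d :* r)) refl sₙ ε δ r ⟩
    sₙ ℚ.* r ℚ.+ ε ℚ.* (δ ℚ.* r)      ≤⟨ ℚ.+-monoʳ-≤ (sₙ ℚ.* r) (ℚ.*-monoˡ-≤-nonNeg ε {{nonNegative (ℚ.<⇒≤ ε>0)}}
                                           (ℚ.*-monoʳ-≤-nonNeg r {{nonNegative r≥0}} δ≤w)) ⟩
    sₙ ℚ.* r ℚ.+ ε ℚ.* (wₙ ℚ.* r)     ≡⟨ cong (sₙ ℚ.* r ℚ.+_) (trans (cong (ε ℚ.*_) (*-recip w>0)) (ℚ.*-identityʳ ε)) ⟩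
    sₙ ℚ.* r ℚ.+ ε                    ∎
  where open ℚ.≤-Reasoning

minᴿ-≤ᴿ : ∀ {k} (f : Fin (ℕ.suc k) → ℝ) i → minᴿ f ≤ᴿ f i
minᴿ-≤ᴿ f i = pointwise⇒≤ᴿ (minᴿ f) (f i) (go f i)
  where
  go : ∀ {k} (f : Fin (ℕ.suc k) → ℝ) i n → seq (minᴿ f) n ℚ.≤ seq (f i) n
  go {ℕ.zero}  f zero    n = ℚ.≤-refl
  go {ℕ.suc k} f zero    n = ℚ.p⊓q≤p (seq (f zero) n) _
  go {ℕ.suc k} f (suc i) n = ℚ.≤-trans (ℚ.p⊓q≤q (seq (f zero) n) _) (go (f ∘ suc) i n)

-- Finite sums

module _ {a} {A : Set a} where

  sumᴿ-nonneg : ∀ (f : A → ℝ) L → (∀ v → 0ᴿ ≤ᴿ f v) → 0ᴿ ≤ᴿ sumᴿ (map f L)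
  sumᴿ-nonneg f []      0≤f = ≤ᴿ-refl 0ᴿ
  sumᴿ-nonneg f (v ∷ L) 0≤f = ≤ᴿ-trans 0ᴿ (f v) (f v +ᴿ sumᴿ (map f L))
    (0≤f v) (x≤ᴿx+y (f v) (sumᴿ (map f L)) (sumᴿ-nonneg f L 0≤f))

  term≤ᴿsumᴿ : ∀ (f : A → ℝ) {L v} → (∀ v → 0ᴿ ≤ᴿ f v) → v ∈ L → f v ≤ᴿ sumᴿ (map f L)
  term≤ᴿsumᴿ f {v ∷ L}         0≤f (here refl) = x≤ᴿx+y (f v) (sumᴿ (map f L)) (sumᴿ-nonneg f L 0≤f)
  term≤ᴿsumᴿ f {u ∷ L} {v = v} 0≤f (there v∈L) = ≤ᴿ-trans (f v) (sumᴿ (map f L)) (f u +ᴿ sumᴿ (map f L))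
    (term≤ᴿsumᴿ f 0≤f v∈L) (y≤ᴿx+y (f u) (sumᴿ (map f L)) (0≤f u))

  sumᴿ-0 : ∀ (L : List A) n → seq (sumᴿ (map (λ _ → 0ᴿ) L)) n ≡ 0ℚ
  sumᴿ-0 []      n = refl
  sumᴿ-0 (v ∷ L) n = trans (cong (0ℚ ℚ.+_) (sumᴿ-0 L n)) (ℚ.+-identityˡ 0ℚ)

  -- Sums and products of reals are computed termwise, so such algebraic identities hold exactly at
  -- every index of the sequences, and not just up to `_≃ᴿ_`.
  sumᴿ-+ : ∀ (f g : A → ℝ) L n →
    seq (sumᴿ (map (λ v → f v +ᴿ g v) L)) n ≡ seq (sumᴿ (map f L) +ᴿ sumᴿ (map g L)) n
  sumᴿ-+ f g []      n = sym (ℚ.+-identityʳ 0ℚ)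
  sumᴿ-+ f g (v ∷ L) n = trans (cong (seq (f v) n ℚ.+ seq (g v) n ℚ.+_) (sumᴿ-+ f g L n))
    (solve 4 (λ a b c d → (a :+ b) :+ (c :+ d) := (a :+ c) :+ (b :+ d)) refl
      (seq (f v) n) (seq (g v) n) (seq (sumᴿ (map f L)) n) (seq (sumᴿ (map g L)) n))

  -- Double counting: the total weight can be collected strategy by strategy or vertex by vertex.
  sumᴿ-swap : ∀ {b} {B : Set b} (f : B → A → ℝ) Ts L n →
    seq (sumᴿ (map (λ T → sumᴿ (map (f T) L)) Ts)) n
      ≡ seq (sumᴿ (map (λ v → sumᴿ (map (λ T → f T v) Ts)) L)) n
  sumᴿ-swap f []       L n = sym (sumᴿ-0 L n)
  sumᴿ-swap f (T ∷ Ts) L n = trans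
    (cong (seq (sumᴿ (map (f T) L)) n ℚ.+_) (sumᴿ-swap f Ts L n))
    (sym (sumᴿ-+ (f T) (λ v → sumᴿ (map (λ T → f T v) Ts)) L n))

  sumᴿ-mono : ∀ (f g : A → ℝ) L → (∀ v → f v ≤ᴿ g v) → sumᴿ (map f L) ≤ᴿ sumᴿ (map g L)
  sumᴿ-mono f g []      f≤g = ≤ᴿ-refl 0ᴿ
  sumᴿ-mono f g (v ∷ L) f≤g =
    +ᴿ-mono-≤ᴿ (f v) (g v) (sumᴿ (map f L)) (sumᴿ (map g L)) (f≤g v) (sumᴿ-mono f g L f≤g)

  *-sumᴿ : ∀ c (f : A → ℝ) L n → seq (c *ᴿ sumᴿ (map f L)) n ≡ seq (sumᴿ (map (λ v → c *ᴿ f v) L)) n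
  *-sumᴿ c f []      n = ℚ.*-zeroʳ (seq c n)
  *-sumᴿ c f (v ∷ L) n = trans (ℚ.*-distribˡ-+ (seq c n) (seq (f v) n) _) (cong (seq c n ℚ.* seq (f v) n ℚ.+_) (*-sumᴿ c f L n))

  length-*-≤ᴿ-sumᴿ : ∀ (f : A → ℝ) w L → (∀ {v} → v ∈ L → w ≤ᴿ f v) → fromℕ (length L) *ᴿ w ≤ᴿ sumᴿ (map f L)
  length-*-≤ᴿ-sumᴿ f w []      w≤f = pointwise≡⇒≤ᴿ (0ᴿ *ᴿ w) 0ᴿ λ n → ℚ.*-zeroˡ (seq w n)
  length-*-≤ᴿ-sumᴿ f w (v ∷ L) w≤f = begin
    fromℕ (1 + length L) *ᴿ w             ∼⟨ pointwise≡⇒≤ᴿ (fromℕ (1 + length L) *ᴿ w) (fromℕ 1 *ᴿ w +ᴿ fromℕ (length L) *ᴿ w)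
                                               (fromℕ-*-distribʳ 1 (length L) w) ⟩
    fromℕ 1 *ᴿ w +ᴿ fromℕ (length L) *ᴿ w ∼⟨ +ᴿ-mono-≤ᴿ (fromℕ 1 *ᴿ w) (f v) (fromℕ (length L) *ᴿ w) (sumᴿ (map f L))
                                               (≤ᴿ-trans (fromℕ 1 *ᴿ w) w (f v)
                                                 (pointwise≡⇒≤ᴿ (fromℕ 1 *ᴿ w) w λ n → ℚ.*-identityˡ (seq w n))
                                                 (w≤f (here refl)))
                                               (length-*-≤ᴿ-sumᴿ f w L (w≤f ∘ there)) ⟩
    f v +ᴿ sumᴿ (map f L)                 ∎
    where open ≤ᴿ-Reasoning

  -- Splitting a list by a predicate and into levels.

  module _ {p} {P : Pred A p} (P? : Decidable P) where

    -- Ensures that removing one level from a list leaves every other level intact.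
    filter-filter-¬ : ∀ {q} {Q : Pred A q} (Q? : Decidable Q) → (∀ {v} → Q v → ¬ P v) →
      ∀ L → filter Q? (filter (¬? ∘ P?) L) ≡ filter Q? L
    filter-filter-¬ Q? Q⇒¬P []      = refl
    filter-filter-¬ Q? Q⇒¬P (v ∷ L) with P? v
    ... | yes Pv = trans (filter-filter-¬ Q? Q⇒¬P L) (sym (filter-reject Q? λ Qv → Q⇒¬P Qv Pv))
    ... | no  _ with Q? v
    ...   | yes _ = cong (v ∷_) (filter-filter-¬ Q? Q⇒¬P L)
    ...   | no  _ = filter-filter-¬ Q? Q⇒¬P L

    length-filter-¬ : ∀ L → length L ≡ length (filter P? L) + length (filter (¬? ∘ P?) L)
    length-filter-¬ []      = refl
    length-filter-¬ (v ∷ L) with P? v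
    ... | yes _ = cong ℕ.suc (length-filter-¬ L)
    ... | no  _ = trans (cong ℕ.suc (length-filter-¬ L)) (sym (ℕ.+-suc _ _))

    sumᴿ-filter-¬ : ∀ f L n →
      seq (sumᴿ (map f L)) n ≡ seq (sumᴿ (map f (filter P? L)) +ᴿ sumᴿ (map f (filter (¬? ∘ P?) L))) n
    sumᴿ-filter-¬ f []      n = sym (ℚ.+-identityʳ 0ℚ)
    sumᴿ-filter-¬ f (v ∷ L) n with P? v
    ... | yes _ = trans (cong (seq (f v) n ℚ.+_) (sumᴿ-filter-¬ f L n)) (sym (ℚ.+-assoc (seq (f v) n)
        (seq (sumᴿ (map f (filter P? L))) n) (seq (sumᴿ (map f (filter (¬? ∘ P?) L))) n)))
    ... | no  _ = trans (cong (seq (f v) n ℚ.+_) (sumᴿ-filter-¬ f L n))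
      (solve 3 (λ a b c → a :+ (b :+ c) := b :+ (a :+ c)) refl (seq (f v) n)
        (seq (sumᴿ (map f (filter P? L))) n) (seq (sumᴿ (map f (filter (¬? ∘ P?) L))) n))

  module _ (d : A → ℕ) where

    fibre : ℕ → List A → List A
    fibre j = filter (λ v → d v ℕ.≟ j)

    -- Induction on `J`. The fibre over its first level `j` carries `c j` times `w`, and the
    -- induction hypothesis covers the list `L′` left after removing that fibre. Once `J` is
    -- exhausted, each remaining element carries `w`. The fibre sizes are given by a separate
    -- function `b`, so that the surplus sum stays the same while the list shrinks.
    fibres-≤ᴿ-sumᴿ : ∀ (b c : ℕ → ℕ) f w L J → Unique J →
      (∀ {v} → v ∈ L → w ≤ᴿ f v) →
      (∀ {j} → j ∈ J → length (fibre j L) ≡ b j) →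
      (∀ {j} → j ∈ J → b j ℕ.≤ c j) →
      (∀ {j} → j ∈ J → fromℕ (c j) *ᴿ w ≤ᴿ sumᴿ (map f (fibre j L))) →
      fromℕ (length L + sum (map (λ j → c j ∸ b j) J)) *ᴿ w ≤ᴿ sumᴿ (map f L)
    fibres-≤ᴿ-sumᴿ b c f w L [] _ w≤f _ _ _ =
      subst (λ k → fromℕ k *ᴿ w ≤ᴿ sumᴿ (map f L)) (sym (ℕ.+-identityʳ (length L)))
        (length-*-≤ᴿ-sumᴿ f w L w≤f)
    fibres-≤ᴿ-sumᴿ b c f w L (j ∷ J) (j∉J ∷ uniq) w≤f len≡b b≤c cw≤ = begin
      fromℕ (length L + (c j ∸ b j + s)) *ᴿ w
        ≡⟨ cong (λ k → fromℕ k *ᴿ w) count ⟩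
      fromℕ (c j + (length L′ + s)) *ᴿ w
        ∼⟨ pointwise≡⇒≤ᴿ (fromℕ (c j + (length L′ + s)) *ᴿ w) (fromℕ (c j) *ᴿ w +ᴿ fromℕ (length L′ + s) *ᴿ w)
             (fromℕ-*-distribʳ (c j) (length L′ + s) w) ⟩
      fromℕ (c j) *ᴿ w +ᴿ fromℕ (length L′ + s) *ᴿ w
        ∼⟨ +ᴿ-mono-≤ᴿ (fromℕ (c j) *ᴿ w) (sumᴿ (map f (fibre j L))) (fromℕ (length L′ + s) *ᴿ w) (sumᴿ (map f L′))
             (cw≤ (here refl))
             (fibres-≤ᴿ-sumᴿ b c f w L′ J uniq (λ v∈ → w≤f (proj₁ (∈-filter⁻ _ {xs = L} v∈)))
               (λ i∈J → trans (cong length (fib i∈J)) (len≡b (there i∈J)))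
               (b≤c ∘ there)
               (λ {i} i∈J → subst (λ F → fromℕ (c i) *ᴿ w ≤ᴿ sumᴿ (map f F)) (sym (fib i∈J)) (cw≤ (there i∈J)))) ⟩
      sumᴿ (map f (fibre j L)) +ᴿ sumᴿ (map f L′)
        ∼⟨ pointwise≡⇒≤ᴿ (sumᴿ (map f (fibre j L)) +ᴿ sumᴿ (map f L′)) (sumᴿ (map f L)) (λ n → sym (sumᴿ-filter-¬ (λ v → d v ℕ.≟ j) f L n)) ⟩
      sumᴿ (map f L) ∎
      where
      open ≤ᴿ-Reasoning
      L′ = filter (¬? ∘ (λ v → d v ℕ.≟ j)) L
      s  = sum (map (λ j → c j ∸ b j) J)

      fib : ∀ {i} → i ∈ J → fibre i L′ ≡ fibre i L
      fib {i} i∈J = filter-filter-¬ (λ v → d v ℕ.≟ j) (λ v → d v ℕ.≟ i)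
        (λ dv≡i dv≡j → lookup j∉J i∈J (trans (sym dv≡j) dv≡i)) L

      count : length L + (c j ∸ b j + s) ≡ c j + (length L′ + s)
      count = trans
        (cong (_+ (c j ∸ b j + s)) (trans (length-filter-¬ (λ v → d v ℕ.≟ j) L) (cong (_+ length L′) (len≡b (here refl)))))
        (trans (interchange (b j) (length L′) (c j ∸ b j) s)
          (cong (_+ (length L′ + s)) (ℕ.m+[n∸m]≡n (b≤c (here refl)))))

-- With `f = id` this splits the vertex list into `r` and the other vertices. A permutation
-- suffices, since it is used only to count levels.
tabulate-↭-punchIn : ∀ {a} {A : Set a} {k} (f : Fin (ℕ.suc k) → A) i →
  tabulate f ↭ f i ∷ tabulate (f ∘ punchIn i)
tabulate-↭-punchIn             f zero    = ↭-refl
tabulate-↭-punchIn {k = ℕ.suc k} f (suc i) =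
  ↭-trans (prep (f zero) (tabulate-↭-punchIn (f ∘ suc) i)) (swap (f zero) (f (suc i)) ↭-refl)

-- Distances and walks

module _ {n : ℕ} where

  path-suffix : ∀ {R} {u v w : Fin n} {k} (p : Walk R u v k) → IsPath p → w ∈ vertices p →
                ∃[ i ] Σ[ q ∈ Walk R w v i ] IsPath q
  path-suffix p@[]      p! (here refl) = _ , p , p!
  path-suffix p@(_ ∷ _) p! (here refl) = _ , p , p!
  path-suffix (_ ∷ p)   (_ ∷ p!) (there w∈p) = path-suffix p p! w∈p

  -- Loop erasure from the far end: if `u` already lies on the path obtained from the tail, the
  -- suffix of that path starting at `u` replaces the whole walk.
  walk⇒path : ∀ {R} {u v : Fin n} {k} → Walk R u v k → ∃[ i ] Σ[ q ∈ Walk R u v i ] IsPath q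
  walk⇒path [] = _ , [] , ([] ∷ [])
  walk⇒path {u = u} (e ∷ p) with walk⇒path p
  ... | _ , q , q! with DecMembership._∈?_ _≟ᶠ_ u (vertices q)
  ...   | yes u∈q = path-suffix q q! u∈q
  ...   | no  u∉q = _ , e ∷ q , (¬Any⇒All¬ _ u∉q ∷ q!)

  module _ (G : Graph n) (conn : Connected G) where

    open Graph G

    dist-walk : ∀ u v → Walk Adj u v (dist G conn u v)
    dist-walk u v = proj₁ (proj₂ (least (λ k → walk? adj? k u v) (conn u v)))

    dist-minimal : ∀ {u v k} → Walk Adj u v k → dist G conn u v ℕ.≤ k
    dist-minimal {u} {v} p =
      ℕ.≮⇒≥ λ k<d → proj₂ (proj₂ (least (λ k → walk? adj? k u v) (conn u v))) _ k<d p

    dist-step : ∀ {u v} r → Adj u v → dist G conn u r ℕ.≤ ℕ.suc (dist G conn v r)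
    dist-step r uv = dist-minimal (uv ∷ dist-walk _ r)

    dist-pos⇒≢ : ∀ {u r} → 0 ℕ.< dist G conn u r → u ≢ r
    dist-pos⇒≢ {r = r} 0<d refl = ℕ.<⇒≱ 0<d (dist-minimal ([] {u = r}))

    ecc-attained : ∀ r → ∃[ x ] dist G conn x r ≡ ecc G conn r
    ecc-attained r with foldr-selective ℕ.⊔-sel 0 (map (λ u → dist G conn u r) (allFin n))
    -- If the maximum is the default value `0` of the fold, `r` itself attains it, being at distance
    -- `0` from itself.
    ... | inj₁ e≡0 = r , trans (ℕ.n≤0⇒n≡0 (dist-minimal ([] {u = r}))) (sym e≡0)
    ... | inj₂ e∈  = let x , _ , e≡ = ∈-map⁻ _ e∈ in x , sym e≡

    -- An edge of T brings the walk at most one level closer to the root, so the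
    -- walk cannot skip level j.
    path-weight : ∀ {r} (T : Strategy G r) {u k} (p : Walk (Strategy.Edge T) u r k) → IsPath p →
      ∀ j i → 0 ℕ.< j → j + i ℕ.≤ dist G conn u r →
      ∃[ v ] (dist G conn v r ≡ j × fromℕ (2 ^ i) *ᴿ ω T u ≤ᴿ ω T v)
    path-weight T [] _ j i 0<j j+i≤ =
      contradiction refl (dist-pos⇒≢ (ℕ.<-≤-trans 0<j (ℕ.m+n≤o⇒m≤o j j+i≤)))
    path-weight {r} T {u} (_∷_ {v = w} e p) (e∉ ∷ p!) j i 0<j j+i≤ with dist G conn u r ℕ.≟ j
    -- Already at level `j`, the inequality `j + i ≤ j` forces `i = 0`, and `u` itself is the
    -- required vertex.
    ... | yes refl with ℕ.n≤0⇒n≡0 (ℕ.+-cancelˡ-≤ j i 0 (ℕ.≤-trans j+i≤ (ℕ.≤-reflexive (sym (ℕ.+-identityʳ j)))))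
    ...   | refl = u , refl , pointwise≡⇒≤ᴿ (fromℕ 1 *ᴿ ω T u) (ω T u) λ n → ℚ.*-identityˡ (seq (ω T u) n)
    path-weight {r} T {u} (_∷_ {v = w} e p) (e∉ ∷ p!) j i 0<j j+i≤ | no d≢j =
      -- Moving to the parent `w` loses at most one level and gains a factor of two, hence
      -- `ℕ.pred i`. The tree path need not be a shortest path in `G`, so `i` can reach `0` while
      -- the path is still beyond level `j`; from then on the factor is given away.
      let v , dv≡j , h = path-weight T p p! j (ℕ.pred i) 0<j (closer i j+i≤)
      in v , dv≡j , (begin
        fromℕ (2 ^ i) *ᴿ ω T u                      ∼⟨ fromℕ-*-monoˡ (ω T u) (T.ω-nonneg u) (2^i≤ i) ⟩
        fromℕ (2 ^ ℕ.pred i * 2) *ᴿ ω T u           ∼⟨ pointwise≡⇒≤ᴿ (fromℕ (2 ^ ℕ.pred i * 2) *ᴿ ω T u) (fromℕ (2 ^ ℕ.pred i) *ᴿ (fromℕ 2 *ᴿ ω T u))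
                                                         (λ n → trans (cong (ℚ._* seq (ω T u) n) (*-/1 (2 ^ ℕ.pred i) 2))
                                                                  (ℚ.*-assoc (+ (2 ^ ℕ.pred i) ℚ./ 1) (+ 2 ℚ./ 1) (seq (ω T u) n))) ⟩
        fromℕ (2 ^ ℕ.pred i) *ᴿ (fromℕ 2 *ᴿ ω T u)  ∼⟨ fromℕ-*-monoʳ (2 ^ ℕ.pred i) (fromℕ 2 *ᴿ ω T u) (ω T w)
                                                         -- `w` is the parent of `u` because `e ∷ p`
                                                         -- is a path to the root. Doubling applies
                                                         -- only away from the root: `u` is strictly
                                                         -- beyond level `j`, so `w` is still at
                                                         -- level at least `j`, which is positive.
                                                         (T.ω-parent (T.edge⊆V (T.edge-sym e)) (T.edge⊆V e)
                                                           (dist-pos⇒≢ (ℕ.<-≤-trans 0<j (ℕ.m+n≤o⇒m≤o j (closer i j+i≤))))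
                                                           (dist-pos⇒≢ (ℕ.<-trans 0<j j<d))
                                                           (e , _ , p , (e∉ ∷ p!))) ⟩
        fromℕ (2 ^ ℕ.pred i) *ᴿ ω T w               ∼⟨ h ⟩
        ω T v                                       ∎)
      where
      open ≤ᴿ-Reasoning
      module T = Strategy T

      j<d : j ℕ.< dist G conn u r
      j<d = ℕ.≤∧≢⇒< (ℕ.m+n≤o⇒m≤o j j+i≤) (d≢j ∘ sym)

      d≤ : dist G conn u r ℕ.≤ ℕ.suc (dist G conn w r)
      d≤ = dist-step r (T.edge⊆adj e)

      closer : ∀ i → j + i ℕ.≤ dist G conn u r → j + ℕ.pred i ℕ.≤ dist G conn w r
      -- For `i = 0` there is no exponent left to lower, and the strict inequality `j<d` pays for
      -- the lost level instead.
      closer ℕ.zero    _    = subst (ℕ._≤ _) (sym (ℕ.+-identityʳ j)) (ℕ.s≤s⁻¹ (ℕ.≤-trans j<d d≤))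
      closer (ℕ.suc i) j+i≤ = ℕ.s≤s⁻¹ (ℕ.≤-trans (ℕ.≤-reflexive (sym (ℕ.+-suc j i))) (ℕ.≤-trans j+i≤ d≤))

      2^i≤ : ∀ i → 2 ^ i ℕ.≤ 2 ^ ℕ.pred i * 2
      2^i≤ ℕ.zero    = ℕ.s≤s ℕ.z≤n
      2^i≤ (ℕ.suc i) = ℕ.≤-reflexive (ℕ.*-comm 2 (2 ^ i))

    -- If `x` lies in the tree, a single vertex of level `j` on the path from `x` to the root
    -- already carries this much weight. Otherwise the weight of `x` is zero and nonnegativity
    -- suffices.
    level-weight : ∀ {r} (T : Strategy G r) x {j i} → 0 ℕ.< j → j + i ℕ.≤ dist G conn x r →
      ∀ L → (∀ {v} → v ≢ r → v ∈ L) →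
      fromℕ (2 ^ i) *ᴿ ω T x ≤ᴿ sumᴿ (map (ω T) (fibre (λ v → dist G conn v r) j L))
    level-weight {r} T x {j} {i} 0<j j+i≤ L L⊇ with x ∈? Strategy.V T
    ... | yes x∈V =
      let _ , p            = Strategy.connected T x∈V (Strategy.root∈V T)
          _ , q , q!       = walk⇒path p
          v , dv≡j , x≤v   = path-weight T q q! j i 0<j j+i≤
          v≢r              = dist-pos⇒≢ (subst (0 ℕ.<_) (sym dv≡j) 0<j)
      in ≤ᴿ-trans (fromℕ (2 ^ i) *ᴿ ω T x) (ω T v) (sumᴿ (map (ω T) (fibre (λ v → dist G conn v r) j L))) x≤v
           (term≤ᴿsumᴿ (ω T) (Strategy.ω-nonneg T) (∈-filter⁺ _ (L⊇ v≢r) dv≡j))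
    ... | no x∉V = begin
      fromℕ (2 ^ i) *ᴿ ω T x   ∼⟨ fromℕ-*-monoʳ (2 ^ i) (ω T x) 0ᴿ (proj₁ (Strategy.ω-outside T x∉V)) ⟩
      fromℕ (2 ^ i) *ᴿ 0ᴿ      ∼⟨ pointwise≡⇒≤ᴿ (fromℕ (2 ^ i) *ᴿ 0ᴿ) 0ᴿ (λ _ → ℚ.*-zeroʳ (+ (2 ^ i) ℚ./ 1)) ⟩
      0ᴿ                       ∼⟨ sumᴿ-nonneg (ω T) (fibre (λ v → dist G conn v r) j L) (Strategy.ω-nonneg T) ⟩
      sumᴿ (map (ω T) (fibre (λ v → dist G conn v r) j L)) ∎
      where open ≤ᴿ-Reasoning

-- The lower bound on the total weight and on the ratio.

module _ {m : ℕ} (G : Graph (2 + m)) (conn : Connected G) (r : Fin (2 + m)) where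

  private
    d = λ v → dist G conn v r
    e = ecc G conn r

  others : List (Fin (2 + m))
  others = map (punchIn r) (allFin (ℕ.suc m))

  ≢⇒∈others : ∀ {v} → v ≢ r → v ∈ others
  ≢⇒∈others v≢r = subst (_∈ others) (punchIn-punchOut (v≢r ∘ sym)) (∈-map⁺ (punchIn r) (∈-allFin _))

  length-others : length others ≡ 1 + m
  length-others = trans (length-map (punchIn r) (allFin (ℕ.suc m))) (length-tabulate (id {A = Fin (ℕ.suc m)}))

  -- `∣N∣` counts over all vertices, but `r` is at distance `0` and so contributes nothing to a
  -- level with `0 < j`.
  ∣N∣-others : ∀ {j} → 0 ℕ.< j → length (fibre d j others) ≡ ∣N∣ G conn j r
  ∣N∣-others {j} 0<j = sym (trans
    (↭-length (filter-↭ (λ v → d v ℕ.≟ j) (tabulate-↭-punchIn id r)))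
    (cong length (trans
      (filter-reject (λ v → d v ℕ.≟ j) (λ dr≡j → dist-pos⇒≢ G conn (subst (0 ℕ.<_) (sym dr≡j) 0<j) refl))
      (cong (fibre d j) (sym (map-tabulate id (punchIn r)))))))

  Isur⁻ : ∀ {j} → j ∈ Isur G conn r → 0 ℕ.< j × j ℕ.≤ e × ∣N∣ G conn j r ℕ.≤ 2 ^ (e ∸ j)
  Isur⁻ j∈ = let _ , 1≤j , j≤ , N< = ∈-filter⁻ _ {xs = upTo e} j∈ in
    1≤j , ℕ.≤-trans j≤ (ℕ.m∸n≤m e 1) , ℕ.<⇒≤ N<

  module _ (𝒯 : StrategySet G r) where

    ωmin-≤ᴿ : ∀ {v} → v ∈ others → ωmin 𝒯 ≤ᴿ ωSet 𝒯 v
    ωmin-≤ᴿ v∈ with ∈-map⁻ (punchIn r) v∈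
    ... | i , _ , refl = minᴿ-≤ᴿ (λ i → ωSet 𝒯 (punchIn r i)) i

    -- `ωmin` is at most the weight at a farthest vertex `x`; `level-weight` is applied to each
    -- strategy at `x`, and the resulting double sum is regrouped by vertices of the level.
    level-ωmin : ∀ {j} → j ∈ Isur G conn r →
      fromℕ (2 ^ (e ∸ j)) *ᴿ ωmin 𝒯 ≤ᴿ sumᴿ (map (ωSet 𝒯) (fibre d j others))
    level-ωmin {j} j∈ = begin
      c *ᴿ ωmin 𝒯
        ∼⟨ fromℕ-*-monoʳ (2 ^ (e ∸ j)) (ωmin 𝒯) (ωSet 𝒯 x) (ωmin-≤ᴿ (≢⇒∈others x≢r)) ⟩
      c *ᴿ ωSet 𝒯 x
        ∼⟨ pointwise≡⇒≤ᴿ (c *ᴿ ωSet 𝒯 x) (sumᴿ (map (λ T → c *ᴿ ω T x) (elements 𝒯)))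
             (*-sumᴿ c (λ T → ω T x) (elements 𝒯)) ⟩
      sumᴿ (map (λ T → c *ᴿ ω T x) (elements 𝒯))
        ∼⟨ sumᴿ-mono (λ T → c *ᴿ ω T x) (λ T → sumᴿ (map (ω T) (fibre d j others))) (elements 𝒯)
             (λ T → level-weight G conn T x 0<j j+i≤ others ≢⇒∈others) ⟩
      sumᴿ (map (λ T → sumᴿ (map (ω T) (fibre d j others))) (elements 𝒯))
        ∼⟨ pointwise≡⇒≤ᴿ (sumᴿ (map (λ T → sumᴿ (map (ω T) (fibre d j others))) (elements 𝒯)))
             (sumᴿ (map (ωSet 𝒯) (fibre d j others))) (sumᴿ-swap ω (elements 𝒯) (fibre d j others)) ⟩
      sumᴿ (map (ωSet 𝒯) (fibre d j others)) ∎
      where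
      open ≤ᴿ-Reasoning
      c    = fromℕ (2 ^ (e ∸ j))
      x    = proj₁ (ecc-attained G conn r)
      dx≡e = proj₂ (ecc-attained G conn r)
      0<j  = proj₁ (Isur⁻ j∈)
      j≤e  = proj₁ (proj₂ (Isur⁻ j∈))
      -- A level in `Isur` satisfies `1 ≤ j ≤ e`, so `e` is positive and the farthest vertex differs
      -- from the root.
      x≢r  = dist-pos⇒≢ G conn (subst (0 ℕ.<_) (sym dx≡e) (ℕ.<-≤-trans 0<j j≤e))
      j+i≤ = ℕ.≤-reflexive (trans (ℕ.m+[n∸m]≡n j≤e) (sym dx≡e))

    total-weight : fromℕ (1 + m + surplus G conn r) *ᴿ ωmin 𝒯 ≤ᴿ ∣ωSet∣ 𝒯
    total-weight = begin
      fromℕ (1 + m + surplus G conn r) *ᴿ ωmin 𝒯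
        ≡⟨ cong (λ l → fromℕ (l + surplus G conn r) *ᴿ ωmin 𝒯) (sym length-others) ⟩
      fromℕ (length others + surplus G conn r) *ᴿ ωmin 𝒯
        -- The levels in `Isur` are distinct as a sublist of `upTo e`. There the truncated
        -- difference in `surplus` is exact, so replacing `∣N∣` by the power of two adds precisely
        -- the surplus to the vertex count.
        ∼⟨ fibres-≤ᴿ-sumᴿ d (λ j → ∣N∣ G conn j r) (λ j → 2 ^ (e ∸ j)) (ωSet 𝒯) (ωmin 𝒯) others (Isur G conn r)
             (filter⁺ _ (upTo⁺ e)) ωmin-≤ᴿ (λ j∈ → ∣N∣-others (proj₁ (Isur⁻ j∈)))
             (λ j∈ → proj₂ (proj₂ (Isur⁻ j∈))) level-ωmin ⟩
      sumᴿ (map (ωSet 𝒯) others)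
        ∼⟨ pointwise≡⇒≤ᴿ (sumᴿ (map (ωSet 𝒯) others)) (sumᴿ (map (λ T → sumᴿ (map (ω T) others)) (elements 𝒯)))
             (λ n → sym (sumᴿ-swap ω (elements 𝒯) others n)) ⟩
      sumᴿ (map (λ T → sumᴿ (map (ω T) others)) (elements 𝒯))
        ≡⟨ cong sumᴿ (map-cong (λ T → cong sumᴿ (sym (map-∘ (allFin (ℕ.suc m))))) (elements 𝒯)) ⟩
      ∣ωSet∣ 𝒯 ∎
      where
      open ≤ᴿ-Reasoning

    wflRatio-bound : (ωmin>0 : 0ᴿ <ᴿ ωmin 𝒯) → fromℕ (1 + m + surplus G conn r) ≤ᴿ wflRatio 𝒯 ωmin>0
    wflRatio-bound ωmin>0 = ≤ᴿ-*-invᴿ (fromℕ (1 + m + surplus G conn r)) (ωmin 𝒯) (∣ωSet∣ 𝒯) ωmin>0 total-weight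

theorem2p1 : (m : ℕ) (G : Graph (2 + m)) (conn : Connected G) (r : Fin (2 + m)) →
    ((ℓ : ℝ) → IsMinWFLRatio G r ℓ → fromℕ ((2 + m) ∸ 1 + surplus G conn r) ≤ᴿ ℓ)
    × ((𝒯 : StrategySet G r) (ωmin>0 : 0ᴿ <ᴿ ωmin 𝒯) → fromℕ ((2 + m) ∸ 1 + surplus G conn r) ≤ᴿ wflRatio 𝒯 ωmin>0)
theorem2p1 m G conn r =
    -- The minimum is attained by some strategy set, so the bound valid for every ratio passes to
    -- `ℓ`.
    (λ ℓ isMin → let 𝒯 , ωmin>0 , ratio≃ℓ = IsMinWFLRatio.attained isMin in
      ≤ᴿ-trans (fromℕ (1 + m + surplus G conn r)) (wflRatio 𝒯 ωmin>0) ℓ (wflRatio-bound G conn r 𝒯 ωmin>0) (proj₁ ratio≃ℓ))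
  , wflRatio-bound G conn r
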